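{- Let $G$ be a finite graph with $n$ vertices such that $\mathrm{Aut}(G)$ is isomorphic to the dihedral group $D_t$ of order $2t$; write its elements as $\pi_{\rho^i}$ and $\pi_{\tau\rho^i}$, $i=0,\dots,t-1$, where $\pi_\rho$ has order $t$, $\pi_\tau^2=\pi_{\rho^0}$ is the identity, $\pi_{\tau}\pi_{\rho^i}=\pi_{\rho^{ -i}}\pi_\tau$, and $\pi_{\tau\rho^i}=\pi_\tau\pi_{\rho^i}$. Let $t=\prod_{i=1}^s p_i^{r_i}$ be the prime factorization of $t$ and $P^*=\{\pi_{\rho^{t/p_1}},\dots,\pi_{\rho^{t/p_s}}\}$. Then for every positive integer $k$ and every $i\in\{0,\dots,t-1\}$, $$N_=(\{\pi_{\rho^0},\pi_{\tau\rho^i}\})=\sum_{\{\pi_{\tau\rho^i}\}\subseteq P\subseteq\{\pi_{\tau\rho^i}\}\cup P^*}(-1)^{|P|-1}N_{\ge}(P),$$ and $$L(G,k)=\sum_{P\subseteq P^*}(-1)^{|P|}N_{\ge}(P)-\sum_{i=0}^{t-1}N_=(\{\pi_{\rho^0},\pi_{\tau\rho^i}\}).$$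
   Context: A $k$-labeling of $G$ is a map $\phi:V(G)\to\{1,\dots,k\}$; an automorphism $\pi$ preserves $\phi$ if $\phi(\pi(v))=\phi(v)$ for all $v$; $\phi$ is distinguishing if only the identity preserves it; $L(G,k)$ is the number of distinguishing $k$-labelings. For $P\subseteq\mathrm{Aut}(G)$, $N_{\ge}(P)$ is the number of $k$-labelings preserved by every automorphism in $P$ (so $N_{\ge}(\emptyset)=k^n$), and $N_=(P)$ is the number of $k$-labelings whose set of preserving automorphisms is exactly $P$. -}

module Defs where

open import Algebra.Bundles using (Group)
open import Algebra.Morphism.Structures using (module GroupMorphisms)
open import Data.Fin.Base using (Fin; finToFun; funToFin; combine; suc; zero)
open import Data.Fin.Properties using (_≟_; all?; any?; finToFun-funToFin)
open import Data.Fin.Subset using (Subset; inside; outside; ⁅_⁆; ⋃) renaming (_∈_ to _∈ₛ_)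
open import Data.Fin.Subset.Properties using (_∈?_; _⊆?_)
open import Data.Integer.Base as ℤ using (ℤ; +_; 0ℤ)
open import Data.Integer.Divisibility.Signed using (_∣_; divides)
open import Data.Integer.Tactic.RingSolver using (solve-∀)
open import Data.List.Base using (List; []; _∷_; _++_; map; filter; foldr; length; allFin; tabulate)
open import Data.Nat.Base as ℕ using (ℕ; zero; suc; _^_; NonZero)
open import Data.Nat.DivMod using (_/_)
open import Data.Nat.ListAction using (product)
open import Data.Nat.Primality using (Prime; prime⇒nonZero)
open import Data.Product.Base using (_×_; _,_; proj₁; proj₂)
open import Data.Vec.Base using ([]; _∷_)
open import Function.Base using (_∘_; id)
open import Function.Bundles using (_⇔_; mk⇔; Equivalence)
open import Function.Definitions using (Injective; Bijective)
open import Level using (0ℓ)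
open import Relation.Binary.Core using (Rel)
open import Relation.Binary.Definitions using (Symmetric; Irreflexive; Decidable)
open import Relation.Binary.PropositionalEquality using (_≡_; refl; sym; trans; cong; cong₂; subst; subst₂; _≗_)
open import Relation.Nullary.Decidable using (Dec; yes; no; map′; _×-dec_; _→-dec_)
open import Relation.Nullary.Negation using (contradiction)
import Relation.Unary as U

record Graph (n : ℕ) : Set₁ where
  field
    _~_      : Rel (Fin n) 0ℓ
    ~-sym    : Symmetric _~_
    ~-irrefl : Irreflexive _≡_ _~_
    _~?_     : Decidable _~_

module _ {n : ℕ} (G : Graph n) where
  open Graph G

  record IsAutomorphism (f : Fin n → Fin n) : Set where
    field
      bijective : Bijective _≡_ _≡_ f
      adjacency : ∀ u v → (u ~ v) ⇔ (f u ~ f v)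

  record Automorphism : Set where
    field
      fun            : Fin n → Fin n
      isAutomorphism : IsAutomorphism fun
    open IsAutomorphism isAutomorphism public

open Automorphism public using (fun)

module _ {n : ℕ} {G : Graph n} where
  open Graph G
  open Automorphism

  infix 4 _≈ₐ_
  _≈ₐ_ : Rel (Automorphism G) 0ℓ
  π ≈ₐ σ = fun π ≗ fun σ

  idₐ : Automorphism G
  idₐ = record
    { fun            = id
    ; isAutomorphism = record
      { bijective = id , λ y → y , id
      ; adjacency = λ _ _ → mk⇔ id id
      }
    }

  infixl 7 _∘ₐ_
  _∘ₐ_ : Automorphism G → Automorphism G → Automorphism G
  π ∘ₐ σ = record
    { fun            = fun π ∘ fun σ
    ; isAutomorphism = record
      { bijective = proj₁ (bijective σ) ∘ proj₁ (bijective π)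
                  , λ z → let (y , πy) = proj₂ (bijective π) z
                              (x , σx) = proj₂ (bijective σ) y
                          in x , λ { refl → πy (σx refl) }
      ; adjacency = λ u v → mk⇔
          (Equivalence.to (adjacency π _ _) ∘ Equivalence.to (adjacency σ u v))
          (Equivalence.from (adjacency σ u v) ∘ Equivalence.from (adjacency π _ _))
      }
    }

  inv : Automorphism G → Fin n → Fin n
  inv π y = proj₁ (proj₂ (bijective π) y)

  fun-inv : ∀ π y → fun π (inv π y) ≡ y
  fun-inv π y = proj₂ (proj₂ (bijective π) y) refl

  inv-fun : ∀ π x → inv π (fun π x) ≡ x
  inv-fun π x = proj₁ (bijective π) (fun-inv π (fun π x))

  infix 8 _⁻¹ₐ
  _⁻¹ₐ : Automorphism G → Automorphism G
  π ⁻¹ₐ = record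
    { fun            = inv π
    ; isAutomorphism = record
      { bijective = (λ {x} {y} eq → trans (sym (fun-inv π x)) (trans (cong (fun π) eq) (fun-inv π y)))
                  , λ y → fun π y , λ { refl → inv-fun π y }
      ; adjacency = λ u v → mk⇔
          (λ u~v → Equivalence.from (adjacency π _ _)
                     (subst₂ _~_ (sym (fun-inv π u)) (sym (fun-inv π v)) u~v))
          (λ iu~iv → subst₂ _~_ (fun-inv π u) (fun-inv π v)
                       (Equivalence.to (adjacency π _ _) iu~iv))
      }
    }

Aut : ∀ {n} → Graph n → Group 0ℓ 0ℓ
Aut G = record
  { Carrier = Automorphism G
  ; _≈_     = _≈ₐ_
  ; _∙_     = _∘ₐ_
  ; ε       = idₐ
  ; _⁻¹     = _⁻¹ₐ
  ; isGroup = record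
    { isMonoid = record
      { isSemigroup = record
        { isMagma = record
          { isEquivalence = record
            { refl  = λ _ → refl
            ; sym   = λ p v → sym (p v)
            ; trans = λ p q v → trans (p v) (q v)
            }
          ; ∙-cong = λ {_} {π′} {σ} p q v → trans (p (fun σ v)) (cong (fun π′) (q v))
          }
        ; assoc = λ _ _ _ _ → refl
        }
      ; identity = (λ _ _ → refl) , (λ _ _ → refl)
      }
    ; inverse = inv-fun , fun-inv
    ; ⁻¹-cong = λ {π} {σ} p v →
        proj₁ (Automorphism.bijective π)
          (trans (fun-inv π v) (sym (trans (p (fun (σ ⁻¹ₐ) v)) (fun-inv σ v))))
    }
  }

-- The dihedral group D t of order 2t (t ≥ 1).  Exponents are integers,
-- identified modulo t by the setoid equality, so that the 2t classes are
-- represented by ρ^ i and τρ^ i with 0 ≤ i < t.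

data Dihedral : Set where
  ρ^_  : ℤ → Dihedral
  τρ^_ : ℤ → Dihedral

infix 9 ρ^_ τρ^_

data DihedralEq (t : ℕ) : Rel Dihedral 0ℓ where
  ρ≈  : ∀ {i j} → + t ∣ i ℤ.- j → DihedralEq t (ρ^ i) (ρ^ j)
  τρ≈ : ∀ {i j} → + t ∣ i ℤ.- j → DihedralEq t (τρ^ i) (τρ^ j)

-- The product is determined by τ ρ^ i = ρ^ (- i) τ and τ² = 1.
infixl 7 _∙ᴰ_
_∙ᴰ_ : Dihedral → Dihedral → Dihedral
ρ^ i  ∙ᴰ ρ^ j  = ρ^ (i ℤ.+ j)
ρ^ i  ∙ᴰ τρ^ j = τρ^ (ℤ.- i ℤ.+ j)
τρ^ i ∙ᴰ ρ^ j  = τρ^ (i ℤ.+ j)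
τρ^ i ∙ᴰ τρ^ j = ρ^ (ℤ.- i ℤ.+ j)

infix 8 _⁻¹ᴰ
_⁻¹ᴰ : Dihedral → Dihedral
(ρ^ i) ⁻¹ᴰ  = ρ^ (ℤ.- i)
(τρ^ i) ⁻¹ᴰ = τρ^ i

D : (t : ℕ) .{{_ : NonZero t}} → Group 0ℓ 0ℓ
D t = record
  { Carrier = Dihedral
  ; _≈_     = DihedralEq t
  ; _∙_     = _∙ᴰ_
  ; ε       = ρ^ 0ℤ
  ; _⁻¹     = _⁻¹ᴰ
  ; isGroup = record
    { isMonoid = record
      { isSemigroup = record
        { isMagma = record
          { isEquivalence = record { refl = ≈refl ; sym = ≈sym ; trans = ≈trans }
          ; ∙-cong = ≈cong
          }
        ; assoc = assoc
        }
      ; identity = identityˡ , identityʳ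
      }
    ; inverse = inverseˡ , inverseʳ
    ; ⁻¹-cong = ⁻¹-cong
    }
  }
  where
  by≡ : ∀ {i j} → i ≡ j → + t ∣ i ℤ.- j
  by≡ {i} refl = divides 0ℤ (lem i (+ t))
    where
    lem : ∀ i u → i ℤ.- i ≡ 0ℤ ℤ.* u
    lem = solve-∀

  negate : ∀ {i j} → + t ∣ i ℤ.- j → + t ∣ (ℤ.- i) ℤ.- (ℤ.- j)
  negate {i} {j} (divides q eq) = divides (ℤ.- q) (trans (lem i j) (trans (cong ℤ.-_ eq) (lem′ q (+ t))))
    where
    lem : ∀ i j → (ℤ.- i) ℤ.- (ℤ.- j) ≡ ℤ.- (i ℤ.- j)
    lem = solve-∀
    lem′ : ∀ q u → ℤ.- (q ℤ.* u) ≡ (ℤ.- q) ℤ.* u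
    lem′ = solve-∀

  add : ∀ {i j k l} → + t ∣ i ℤ.- j → + t ∣ k ℤ.- l → + t ∣ (i ℤ.+ k) ℤ.- (j ℤ.+ l)
  add {i} {j} {k} {l} (divides q eq) (divides r eq′) =
    divides (q ℤ.+ r) (trans (lem i j k l) (trans (cong₂ ℤ._+_ eq eq′) (lem′ q r (+ t))))
    where
    lem : ∀ i j k l → (i ℤ.+ k) ℤ.- (j ℤ.+ l) ≡ (i ℤ.- j) ℤ.+ (k ℤ.- l)
    lem = solve-∀
    lem′ : ∀ q r u → q ℤ.* u ℤ.+ r ℤ.* u ≡ (q ℤ.+ r) ℤ.* u
    lem′ = solve-∀

  flip : ∀ {i j} → + t ∣ i ℤ.- j → + t ∣ j ℤ.- i
  flip {i} {j} d = subst (+ t ∣_) (lem i j) (negate {i} {j} d)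
    where
    lem : ∀ i j → (ℤ.- i) ℤ.- (ℤ.- j) ≡ j ℤ.- i
    lem = solve-∀

  chain : ∀ {i j k} → + t ∣ i ℤ.- j → + t ∣ j ℤ.- k → + t ∣ i ℤ.- k
  chain {i} {j} {k} d e = subst (+ t ∣_) (lem i j k) (add {i} {j} {j} {k} d e)
    where
    lem : ∀ i j k → (i ℤ.+ j) ℤ.- (j ℤ.+ k) ≡ i ℤ.- k
    lem = solve-∀

  ≈refl : ∀ {x} → DihedralEq t x x
  ≈refl {ρ^ i}  = ρ≈ (by≡ {i} refl)
  ≈refl {τρ^ i} = τρ≈ (by≡ {i} refl)

  ≈sym : ∀ {x y} → DihedralEq t x y → DihedralEq t y x
  ≈sym (ρ≈ {i} {j} d)  = ρ≈ (flip {i} {j} d)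
  ≈sym (τρ≈ {i} {j} d) = τρ≈ (flip {i} {j} d)

  ≈trans : ∀ {x y z} → DihedralEq t x y → DihedralEq t y z → DihedralEq t x z
  ≈trans (ρ≈ {i} {j} d) (ρ≈ {j = k} e)   = ρ≈ (chain {i} {j} {k} d e)
  ≈trans (τρ≈ {i} {j} d) (τρ≈ {j = k} e) = τρ≈ (chain {i} {j} {k} d e)

  ≈cong : ∀ {x y u v} → DihedralEq t x y → DihedralEq t u v → DihedralEq t (x ∙ᴰ u) (y ∙ᴰ v)
  ≈cong (ρ≈ {i} {j} d) (ρ≈ {k} {l} e)   = ρ≈ (add {i} {j} {k} {l} d e)
  ≈cong (ρ≈ {i} {j} d) (τρ≈ {k} {l} e)  = τρ≈ (add {ℤ.- i} {ℤ.- j} {k} {l} (negate {i} {j} d) e)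
  ≈cong (τρ≈ {i} {j} d) (ρ≈ {k} {l} e)  = τρ≈ (add {i} {j} {k} {l} d e)
  ≈cong (τρ≈ {i} {j} d) (τρ≈ {k} {l} e) = ρ≈ (add {ℤ.- i} {ℤ.- j} {k} {l} (negate {i} {j} d) e)

  +++ : ∀ i j k → i ℤ.+ j ℤ.+ k ≡ i ℤ.+ (j ℤ.+ k)
  +++ = solve-∀

  neg₁ : ∀ i j k → ℤ.- (i ℤ.+ j) ℤ.+ k ≡ ℤ.- i ℤ.+ (ℤ.- j ℤ.+ k)
  neg₁ = solve-∀

  neg₂ : ∀ i j k → ℤ.- (ℤ.- i ℤ.+ j) ℤ.+ k ≡ i ℤ.+ (ℤ.- j ℤ.+ k)
  neg₂ = solve-∀

  assoc : ∀ x y z → DihedralEq t (x ∙ᴰ y ∙ᴰ z) (x ∙ᴰ (y ∙ᴰ z))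
  assoc (ρ^ i)  (ρ^ j)  (ρ^ k)  = ρ≈ (by≡ (+++ i j k))
  assoc (ρ^ i)  (ρ^ j)  (τρ^ k) = τρ≈ (by≡ (neg₁ i j k))
  assoc (ρ^ i)  (τρ^ j) (ρ^ k)  = τρ≈ (by≡ (+++ (ℤ.- i) j k))
  assoc (ρ^ i)  (τρ^ j) (τρ^ k) = ρ≈ (by≡ (neg₂ i j k))
  assoc (τρ^ i) (ρ^ j)  (ρ^ k)  = τρ≈ (by≡ (+++ i j k))
  assoc (τρ^ i) (ρ^ j)  (τρ^ k) = ρ≈ (by≡ (neg₁ i j k))
  assoc (τρ^ i) (τρ^ j) (ρ^ k)  = ρ≈ (by≡ (+++ (ℤ.- i) j k))
  assoc (τρ^ i) (τρ^ j) (τρ^ k) = τρ≈ (by≡ (neg₂ i j k))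

  0+ : ∀ i → 0ℤ ℤ.+ i ≡ i
  0+ = solve-∀

  -0+ : ∀ i → ℤ.- 0ℤ ℤ.+ i ≡ i
  -0+ = solve-∀

  +0 : ∀ i → i ℤ.+ 0ℤ ≡ i
  +0 = solve-∀

  -+ : ∀ i → ℤ.- i ℤ.+ i ≡ 0ℤ
  -+ = solve-∀

  +- : ∀ i → i ℤ.+ ℤ.- i ≡ 0ℤ
  +- = solve-∀

  identityˡ : ∀ x → DihedralEq t (ρ^ 0ℤ ∙ᴰ x) x
  identityˡ (ρ^ i)  = ρ≈ (by≡ (0+ i))
  identityˡ (τρ^ i) = τρ≈ (by≡ (-0+ i))

  identityʳ : ∀ x → DihedralEq t (x ∙ᴰ ρ^ 0ℤ) x
  identityʳ (ρ^ i)  = ρ≈ (by≡ (+0 i))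
  identityʳ (τρ^ i) = τρ≈ (by≡ (+0 i))

  inverseˡ : ∀ x → DihedralEq t (x ⁻¹ᴰ ∙ᴰ x) (ρ^ 0ℤ)
  inverseˡ (ρ^ i)  = ρ≈ (by≡ (-+ i))
  inverseˡ (τρ^ i) = ρ≈ (by≡ (-+ i))

  inverseʳ : ∀ x → DihedralEq t (x ∙ᴰ x ⁻¹ᴰ) (ρ^ 0ℤ)
  inverseʳ (ρ^ i)  = ρ≈ (by≡ (+- i))
  inverseʳ (τρ^ i) = ρ≈ (by≡ (-+ i))

  ⁻¹-cong : ∀ {x y} → DihedralEq t x y → DihedralEq t (x ⁻¹ᴰ) (y ⁻¹ᴰ)
  ⁻¹-cong (ρ≈ {i} {j} d) = ρ≈ (negate {i} {j} d)
  ⁻¹-cong (τρ≈ d)        = τρ≈ d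

IsIsomorphism : (H K : Group 0ℓ 0ℓ) → (Group.Carrier H → Group.Carrier K) → Set
IsIsomorphism H K = GroupMorphisms.IsGroupIsomorphism (Group.rawGroup H) (Group.rawGroup K)

-- Sets of automorphisms.  The codes funToFin f : Fin (n ^ n) enumerate the
-- self-maps f of Fin n, each exactly once up to _≗_; a set of automorphisms
-- is represented by the set of codes of its members.  The predicates below
-- quantify over automorphisms only, so codes of other maps play no role.

MapSet : ℕ → Set
MapSet n = Subset (n ^ n)

module _ {n : ℕ} {G : Graph n} where

  infix 4 _∈_
  _∈_ : Automorphism G → MapSet n → Set
  π ∈ P = funToFin (fun π) ∈ₛ P

  ｛_｝ : Automorphism G → MapSet n
  ｛ π ｝ = ⁅ funToFin (fun π) ⁆

  setOf : List (Automorphism G) → MapSet n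
  setOf πs = ⋃ (map ｛_｝ πs)

Labeling : ℕ → ℕ → Set
Labeling n k = Fin n → Fin k

module _ {n k : ℕ} where

  Preserves : {G : Graph n} → Automorphism G → Labeling n k → Set
  Preserves π φ = ∀ v → φ (fun π v) ≡ φ v

  Distinguishing : Graph n → Labeling n k → Set
  Distinguishing G φ = (π : Automorphism G) → Preserves π φ → π ≈ₐ idₐ

  PreservedByAll : Graph n → MapSet n → Labeling n k → Set
  PreservedByAll G P φ = (π : Automorphism G) → π ∈ P → Preserves π φ

  PreservedByExactly : Graph n → MapSet n → Labeling n k → Set
  PreservedByExactly G P φ = (π : Automorphism G) → π ∈ P ⇔ Preserves π φ

funToFin-cong : ∀ {m l} {f g : Fin m → Fin l} → f ≗ g → funToFin f ≡ funToFin g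
funToFin-cong {zero}  _   = refl
funToFin-cong {suc m} f≗g = cong₂ combine (f≗g zero) (funToFin-cong (f≗g ∘ suc))

module _ {n : ℕ} (G : Graph n) where
  open Graph G

  private
    _⇔-dec_ : {A B : Set} → Dec A → Dec B → Dec (A ⇔ B)
    a? ⇔-dec b? = map′ (λ (f , g) → mk⇔ f g) (λ e → Equivalence.to e , Equivalence.from e)
                       ((a? →-dec b?) ×-dec (b? →-dec a?))

  isAutomorphism? : U.Decidable (IsAutomorphism G)
  isAutomorphism? f = map′ to from
    (all? (λ x → all? λ y → (f x ≟ f y) →-dec (x ≟ y)) ×-dec
     all? (λ y → any? λ x → f x ≟ y) ×-dec
     all? (λ u → all? λ v → (u ~? v) ⇔-dec (f u ~? f v)))
    where
    to : _ → IsAutomorphism G f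
    to (inj , sur , adj) = record
      { bijective = (λ {x} {y} → inj x y) , λ y → proj₁ (sur y) , λ { refl → proj₂ (sur y) }
      ; adjacency = adj
      }
    from : IsAutomorphism G f → _
    from a = (λ x y → proj₁ bijective {x} {y})
           , (λ y → proj₁ (proj₂ bijective y) , proj₂ (proj₂ bijective y) refl)
           , adjacency
      where open IsAutomorphism a

  isAutomorphism-resp : ∀ {f g} → f ≗ g → IsAutomorphism G f → IsAutomorphism G g
  isAutomorphism-resp {f} {g} f≗g a = record
    { bijective = (λ {x} {y} eq → proj₁ bijective (trans (f≗g x) (trans eq (sym (f≗g y)))))
                , λ y → proj₁ (proj₂ bijective y)
                      , λ {z} eq → trans (sym (f≗g z)) (proj₂ (proj₂ bijective y) eq)
    ; adjacency = λ u v → mk⇔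
        (λ e → subst₂ _~_ (f≗g u) (f≗g v) (Equivalence.to (adjacency u v) e))
        (λ e → Equivalence.from (adjacency u v) (subst₂ _~_ (sym (f≗g u)) (sym (f≗g v)) e))
    }
    where open IsAutomorphism a

  allAutomorphisms? : {Q : Automorphism G → Set} →
                      (∀ {π σ} → π ≈ₐ σ → Q π → Q σ) → U.Decidable Q → Dec (∀ π → Q π)
  allAutomorphisms? {Q} resp Q? = map′ to from (all? code?)
    where
    Code : Fin (n ^ n) → Set
    Code c = (a : IsAutomorphism G (finToFun c)) → Q (record { isAutomorphism = a })

    code? : U.Decidable Code
    code? c with isAutomorphism? (finToFun c)
    ... | no ¬a = yes λ a → contradiction a ¬a
    ... | yes a = map′ (λ q _ → resp (λ _ → refl) q) (λ h → h a) (Q? _)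

    to : (∀ c → Code c) → ∀ π → Q π
    to h π = resp (finToFun-funToFin (fun π))
      (h (funToFin (fun π))
         (isAutomorphism-resp (λ v → sym (finToFun-funToFin (fun π) v))
                              (Automorphism.isAutomorphism π)))

    from : (∀ π → Q π) → ∀ c → Code c
    from h c a = h _

  ∈-resp : ∀ P {π σ : Automorphism G} → π ≈ₐ σ → π ∈ P → σ ∈ P
  ∈-resp P π≈σ = subst (_∈ₛ P) (funToFin-cong π≈σ)

  preserves-resp : ∀ {k} (φ : Labeling n k) {π σ : Automorphism G} →
                   π ≈ₐ σ → Preserves π φ → Preserves σ φ
  preserves-resp φ π≈σ p v = trans (cong φ (sym (π≈σ v))) (p v)

  ≈ₐ-sym : {π σ : Automorphism G} → π ≈ₐ σ → σ ≈ₐ π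
  ≈ₐ-sym p v = sym (p v)

  module _ {k : ℕ} where

    preserves? : (π : Automorphism G) (φ : Labeling n k) → Dec (Preserves π φ)
    preserves? π φ = all? λ v → φ (fun π v) ≟ φ v

    distinguishing? : U.Decidable (Distinguishing {k = k} G)
    distinguishing? φ = allAutomorphisms?
      (λ {π} {σ} e h p v → trans (sym (e v)) (h (preserves-resp φ {σ} {π} (≈ₐ-sym {π} {σ} e) p) v))
      (λ π → preserves? π φ →-dec all? λ v → fun π v ≟ v)

    preservedByAll? : ∀ P → U.Decidable (PreservedByAll {k = k} G P)
    preservedByAll? P φ = allAutomorphisms?
      (λ {π} {σ} e h m → preserves-resp φ {π} {σ} e (h (∈-resp P {σ} {π} (≈ₐ-sym {π} {σ} e) m)))
      (λ π → (_ ∈? P) →-dec preserves? π φ)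

    preservedByExactly? : ∀ P → U.Decidable (PreservedByExactly {k = k} G P)
    preservedByExactly? P φ = allAutomorphisms?
      (λ {π} {σ} e h → mk⇔
        (λ m → preserves-resp φ {π} {σ} e
                 (Equivalence.to h (∈-resp P {σ} {π} (≈ₐ-sym {π} {σ} e) m)))
        (λ p → ∈-resp P {π} {σ} e
                 (Equivalence.from h (preserves-resp φ {σ} {π} (≈ₐ-sym {π} {σ} e) p))))
      (λ π → (_ ∈? P) ⇔-dec preserves? π φ)

-- finToFun enumerates the labelings, each exactly once up to _≗_.
#labelings : ∀ {n k} {Q : Labeling n k → Set} → U.Decidable Q → ℕ
#labelings {n} {k} Q? = length (filter (Q? ∘ finToFun) (allFin (k ^ n)))

module _ {n : ℕ} (G : Graph n) (k : ℕ) where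

  L : ℕ
  L = #labelings (distinguishing? G {k})

  N≥ : MapSet n → ℕ
  N≥ P = #labelings (preservedByAll? G {k} P)

  N₌ : MapSet n → ℕ
  N₌ P = #labelings (preservedByExactly? G {k} P)

record PrimePowerFactorisation (t : ℕ) : Set where
  field
    s             : ℕ
    p             : Fin s → ℕ
    r             : Fin s → ℕ
    p-prime       : ∀ j → Prime (p j)
    p-distinct    : Injective _≡_ _≡_ p
    r-positive    : ∀ j → 1 ℕ.≤ r j
    factorisation : t ≡ product (tabulate λ j → p j ^ r j)

  t/p : Fin s → ℕ
  t/p j = (t / p j) {{prime⇒nonZero (p-prime j)}}

P* : ∀ {n} {G : Graph n} {t} → (Dihedral → Automorphism G) → PrimePowerFactorisation t → MapSet n
P* π F = setOf (tabulate λ j → π (ρ^ (+ t/p j)))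
  where open PrimePowerFactorisation F

Σℤ : {A : Set} → List A → (A → ℤ) → ℤ
Σℤ xs f = foldr ℤ._+_ 0ℤ (map f xs)

subsets : ∀ m → List (Subset m)
subsets zero    = [] ∷ []
subsets (suc m) = map (outside ∷_) (subsets m) ++ map (inside ∷_) (subsets m)

between : ∀ {m} → Subset m → Subset m → List (Subset m)
between {m} A B = filter (λ P → (A ⊆? P) ×-dec (P ⊆? B)) (subsets m)

{-# OPTIONS --safe #-}
module Submission where

-- Every count is a sum over labelings φ of truth values, so both identities are proved for a
-- fixed φ with stabiliser H ≤ D_t.  The alternating sum over X ⊆ P ⊆ Y of the sets P fixing φ
-- is ± the truth value of X = Y ∩ H.  A subgroup of the rotations avoiding P* is trivial, and
-- then H contains at most one reflection, since two of them differ by a rotation.  Hence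
-- {τρ^i} = ({τρ^i} ∪ P*) ∩ H iff H = {1 , τρ^i}, and ∅ = P* ∩ H iff H is trivial or {1 , τρ^i}
-- for exactly one i.

open import Defs
open import Algebra.Bundles using (Group)
open import Algebra.Morphism.Structures using (module GroupMorphisms)
open import Data.Bool.Base using (Bool; true; false; _∧_)
import Data.Bool.Properties as Bool
open import Data.Fin.Base using (Fin; toℕ; fromℕ<; finToFun; funToFin; zero; suc)
open import Data.Fin.Properties using (toℕ-fromℕ<; toℕ<n; toℕ-injective; finToFun-funToFin; any?; all?)
open import Data.Fin.Subset using (Subset; inside; outside; _∪_; _∩_; ⊥; ⁅_⁆; ∣_∣; _⊆_; Empty) renaming (_∈_ to _∈ₛ_)
open import Data.Fin.Subset.Properties using (_⊆?_; p∩q⊆p; p∩q⊆q; x∈⁅x⁆; x∈⁅y⁆⇒x≡y; x∈p∪q⁺; x∈p∪q⁻; x∈p∩q⁺; x∈p∩q⁻; ∉⊥; Empty-unique; ⊆-antisym; ∣⁅x⁆∣≡1; ∣⊥∣≡0; p⊆q⇒∣p∣≤∣q∣)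
open import Data.Integer.Base using (ℤ; +_; -[1+_]; 0ℤ; 1ℤ; -1ℤ; -_; _+_; _*_; _-_; _^_) renaming (∣_∣ to ∣_∣ᶻ)
open import Data.Integer.DivMod using (_%ℕ_; _/ℕ_; n%ℕd<d; a≡a%ℕn+[a/ℕn]*n)
open import Data.Integer.Divisibility.Signed using (_∣_; divides; ∣ᵤ⇒∣; ∣⇒∣ᵤ)
open import Data.Integer.Properties as ℤ using (+-assoc; +-identityˡ; +-identityʳ; +-inverseʳ; *-identityˡ; *-zeroʳ; *-distribˡ-+)
open import Data.Integer.Tactic.RingSolver using (solve-∀)
open import Data.List.Base using (List; []; _∷_; _++_; map; filter; length; tabulate; allFin)
open import Data.List.Membership.Propositional.Properties using (∈-tabulate⁺)
open import Data.List.Relation.Unary.All using (_∷_)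
open import Data.Nat.Base as ℕ using (ℕ; zero; suc; 2+; NonZero; _∸_)
import Data.Nat.Divisibility as ℕ
open import Data.Nat.DivMod using (_/_; m*n/n≡m; m/n*n≡m; m/n<m)
open import Data.Nat.GCD using (GCD; module Bézout)
open import Data.Nat.ListAction using (product)
open import Data.Nat.ListAction.Properties using (∈⇒∣product)
open import Data.Nat.Primality using (Prime; prime⇒nonZero; prime⇒nonTrivial; prime⇒irreducible; euclidsLemma; ¬prime[1])
open import Data.Nat.Primality.Factorisation using (factorise)
import Data.Nat.Properties as ℕ
open import Data.Product.Base using (∃; _×_; _,_; proj₁; proj₂)
open import Data.Sum.Base using (inj₁; inj₂)
open import Data.Vec.Base as Vec using ([]; _∷_)
open import Data.Vec.Properties using (≡-dec; lookup∘tabulate; []=⇒lookup; lookup⇒[]=)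
open import Function.Base using (_∘_; id; case_of_)
open import Function.Bundles using (_⇔_; mk⇔; Equivalence)
open import Relation.Binary.Definitions using (DecidableEquality)
open import Relation.Binary.PropositionalEquality using (_≡_; _≢_; refl; sym; trans; cong; cong₂; subst; module ≡-Reasoning)
open import Relation.Nullary.Decidable using (Dec; does; yes; no; _×-dec_; ¬?; does-⇔; dec-true; dec-false)
open import Relation.Nullary.Negation using (¬_; contradiction)
import Relation.Unary as U

private variable
  A B : Set
  n k m : ℕ

-- Truth values as integers, and finite sums.

⟦_⟧ᵇ : Bool → ℤ
⟦ true ⟧ᵇ  = 1ℤ
⟦ false ⟧ᵇ = 0ℤ

-- Depends on `does a?` alone, so that truth values of inclusions and equalities of subsets reduce
-- along the heads of the vectors, as the case analysis in `Σℤ-between` requires.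
⟦_⟧ : Dec A → ℤ
⟦ a? ⟧ = ⟦ does a? ⟧ᵇ

⟦⟧-cong : A ⇔ B → (a? : Dec A) (b? : Dec B) → ⟦ a? ⟧ ≡ ⟦ b? ⟧
⟦⟧-cong A⇔B a? b? = cong ⟦_⟧ᵇ (does-⇔ A⇔B a? b?)

⟦⟧-true : (a? : Dec A) → A → ⟦ a? ⟧ ≡ 1ℤ
⟦⟧-true a? a = cong ⟦_⟧ᵇ (dec-true a? a)

⟦⟧-false : (a? : Dec A) → ¬ A → ⟦ a? ⟧ ≡ 0ℤ
⟦⟧-false a? ¬a = cong ⟦_⟧ᵇ (dec-false a? ¬a)

⟦⟧-× : (a? : Dec A) (b? : Dec B) → ⟦ a? ×-dec b? ⟧ ≡ ⟦ a? ⟧ * ⟦ b? ⟧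
⟦⟧-× a? b? with does a?
... | true  = sym (*-identityˡ ⟦ b? ⟧)
... | false = refl

Σℤ-cong : (xs : List A) {f g : A → ℤ} → (∀ x → f x ≡ g x) → Σℤ xs f ≡ Σℤ xs g
Σℤ-cong []       f≗g = refl
Σℤ-cong (x ∷ xs) f≗g = cong₂ _+_ (f≗g x) (Σℤ-cong xs f≗g)

Σℤ-zero : (xs : List A) {f : A → ℤ} → (∀ x → f x ≡ 0ℤ) → Σℤ xs f ≡ 0ℤ
Σℤ-zero []       f≗0 = refl
Σℤ-zero (x ∷ xs) f≗0 = cong₂ _+_ (f≗0 x) (Σℤ-zero xs f≗0)

Σℤ-distrib-+ : (xs : List A) (f g : A → ℤ) → Σℤ xs (λ x → f x + g x) ≡ Σℤ xs f + Σℤ xs g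
Σℤ-distrib-+ []       f g = refl
Σℤ-distrib-+ (x ∷ xs) f g =
  trans (cong (_+_ (f x + g x)) (Σℤ-distrib-+ xs f g)) (interchange (f x) (g x) _ _)
  where
  interchange : ∀ a b c d → a + b + (c + d) ≡ a + c + (b + d)
  interchange = solve-∀

Σℤ-distribˡ-* : (xs : List A) (a : ℤ) (f : A → ℤ) → Σℤ xs (λ x → a * f x) ≡ a * Σℤ xs f
Σℤ-distribˡ-* []       a f = sym (*-zeroʳ a)
Σℤ-distribˡ-* (x ∷ xs) a f =
  trans (cong (_+_ (a * f x)) (Σℤ-distribˡ-* xs a f)) (sym (*-distribˡ-+ a (f x) _))

Σℤ-neg : (xs : List A) (f : A → ℤ) → Σℤ xs (λ x → - f x) ≡ - Σℤ xs f
Σℤ-neg []       f = refl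
Σℤ-neg (x ∷ xs) f = trans (cong (_+_ (- f x)) (Σℤ-neg xs f)) (neg-+ (f x) _)
  where
  neg-+ : ∀ a b → - a + - b ≡ - (a + b)
  neg-+ = solve-∀

Σℤ-distrib-- : (xs : List A) (f g : A → ℤ) → Σℤ xs (λ x → f x - g x) ≡ Σℤ xs f - Σℤ xs g
Σℤ-distrib-- xs f g = trans (Σℤ-distrib-+ xs f (-_ ∘ g)) (cong (_+_ (Σℤ xs f)) (Σℤ-neg xs g))

Σℤ-comm : (xs : List A) (ys : List B) (f : A → B → ℤ) →
          Σℤ xs (λ x → Σℤ ys (f x)) ≡ Σℤ ys (λ y → Σℤ xs (λ x → f x y))
Σℤ-comm []       ys f = sym (Σℤ-zero ys (λ _ → refl))
Σℤ-comm (x ∷ xs) ys f =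
  trans (cong (_+_ (Σℤ ys (f x))) (Σℤ-comm xs ys f)) (sym (Σℤ-distrib-+ ys (f x) _))

Σℤ-++ : (xs ys : List A) (f : A → ℤ) → Σℤ (xs ++ ys) f ≡ Σℤ xs f + Σℤ ys f
Σℤ-++ []       ys f = sym (+-identityˡ (Σℤ ys f))
Σℤ-++ (x ∷ xs) ys f = trans (cong (_+_ (f x)) (Σℤ-++ xs ys f)) (sym (+-assoc (f x) _ _))

Σℤ-map : (g : A → B) (xs : List A) (f : B → ℤ) → Σℤ (map g xs) f ≡ Σℤ xs (f ∘ g)
Σℤ-map g []       f = refl
Σℤ-map g (x ∷ xs) f = cong (_+_ (f (g x))) (Σℤ-map g xs f)

Σℤ-filter : {Q : A → Set} (Q? : U.Decidable Q) (xs : List A) (f : A → ℤ) →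
            Σℤ (filter Q? xs) f ≡ Σℤ xs (λ x → ⟦ Q? x ⟧ * f x)
Σℤ-filter Q? []       f = refl
Σℤ-filter Q? (x ∷ xs) f with does (Q? x)
... | true  = cong₂ _+_ (sym (*-identityˡ (f x))) (Σℤ-filter Q? xs f)
... | false = trans (Σℤ-filter Q? xs f) (sym (+-identityˡ _))

-- Agreement on the retained elements only is what the sign change in `Σℤ-reflection` can offer: for
-- empty P, `-1ℤ ^ (∣ P ∣ ∸ 1)` is 1 while `- (-1ℤ ^ ∣ P ∣)` is -1.
Σℤ-filter-cong : {Q : A → Set} (Q? : U.Decidable Q) (xs : List A) {f g : A → ℤ} →
                 (∀ x → Q x → f x ≡ g x) → Σℤ (filter Q? xs) f ≡ Σℤ (filter Q? xs) g
Σℤ-filter-cong Q? []       f≗g = refl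
Σℤ-filter-cong Q? (x ∷ xs) f≗g with Q? x
... | yes q = cong₂ _+_ (f≗g x q) (Σℤ-filter-cong Q? xs f≗g)
... | no _  = Σℤ-filter-cong Q? xs f≗g

length-filter : {Q : A → Set} (Q? : U.Decidable Q) (xs : List A) →
                + length (filter Q? xs) ≡ Σℤ xs (λ x → ⟦ Q? x ⟧)
length-filter Q? []       = refl
length-filter Q? (x ∷ xs) with does (Q? x)
... | true  = cong (_+_ 1ℤ) (length-filter Q? xs)
... | false = trans (length-filter Q? xs) (sym (+-identityˡ _))

Σℤ-tabulate-single : ∀ {m} (g : Fin m → A) (f : A → ℤ) (i : Fin m) →
                     (∀ j → j ≢ i → f (g j) ≡ 0ℤ) → Σℤ (tabulate g) f ≡ f (g i)
Σℤ-tabulate-single g f zero    f≡0 =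
  trans (cong (_+_ (f (g zero))) (zeros (g ∘ suc) λ j → f≡0 (suc j) λ ())) (+-identityʳ _)
  where
  zeros : ∀ {m} (h : Fin m → _) → (∀ j → f (h j) ≡ 0ℤ) → Σℤ (tabulate h) f ≡ 0ℤ
  zeros {zero}  h h≡0 = refl
  zeros {suc m} h h≡0 = cong₂ _+_ (h≡0 zero) (zeros (h ∘ suc) (h≡0 ∘ suc))
Σℤ-tabulate-single g f (suc i) f≡0 = trans
  (cong₂ _+_ (f≡0 zero λ ()) (Σℤ-tabulate-single (g ∘ suc) f i λ j j≢i →
    f≡0 (suc j) λ { refl → j≢i refl }))
  (+-identityˡ _)

-- Alternating sums over intervals of subsets.

infix 4 _≟ˢ_
_≟ˢ_ : ∀ {m} → DecidableEquality (Subset m)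
_≟ˢ_ = ≡-dec Bool._≟_

-- The Möbius function of the Boolean lattice.
Σℤ-between : ∀ {m} (X Y : Subset m) →
             Σℤ (between X Y) (λ P → -1ℤ ^ ∣ P ∣) ≡ ⟦ X ≟ˢ Y ⟧ * -1ℤ ^ ∣ X ∣
Σℤ-between {m} X Y = trans (Σℤ-filter _ (subsets m) _) (go X Y)
  where
  term : ∀ {m} → Subset m → Subset m → Subset m → ℤ
  term X Y P = ⟦ (X ⊆? P) ×-dec (P ⊆? Y) ⟧ * -1ℤ ^ ∣ P ∣

  split : ∀ {m} (X Y : Subset (suc m)) →
          Σℤ (subsets (suc m)) (term X Y) ≡
          Σℤ (subsets m) (term X Y ∘ (outside ∷_)) + Σℤ (subsets m) (term X Y ∘ (inside ∷_))
  split {m} X Y = trans (Σℤ-++ (map (outside ∷_) (subsets m)) _ _)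
    (cong₂ _+_ (Σℤ-map _ (subsets m) _) (Σℤ-map _ (subsets m) _))

  swap : ∀ a b → a * (-1ℤ * b) ≡ -1ℤ * (a * b)
  swap = solve-∀

  inside-zero : ∀ {m} (X P : Subset m) → ⟦ does (X ⊆? P) ∧ false ⟧ᵇ * -1ℤ ^ suc ∣ P ∣ ≡ 0ℤ
  inside-zero X P = cong (λ b → ⟦ b ⟧ᵇ * -1ℤ ^ suc ∣ P ∣) (Bool.∧-zeroʳ (does (X ⊆? P)))

  go : ∀ {m} (X Y : Subset m) → Σℤ (subsets m) (term X Y) ≡ ⟦ X ≟ˢ Y ⟧ * -1ℤ ^ ∣ X ∣
  go [] [] = refl
  -- Sets containing the new element are not below `outside ∷ Y` and contribute nothing.
  go {suc m} (outside ∷ X) (outside ∷ Y) =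
    trans (split (outside ∷ X) (outside ∷ Y))
      (trans (cong₂ _+_ (go X Y) (Σℤ-zero (subsets m) (inside-zero X)))
        (+-identityʳ _))
  -- The new element is optional and adding it flips the sign, so the two halves cancel. The
  -- right-hand side vanishes because the heads differ.
  go {suc m} (outside ∷ X) (inside ∷ Y) =
    trans (split (outside ∷ X) (inside ∷ Y))
      (trans (cong (_+_ (Σℤ (subsets m) (term X Y)))
               (trans (Σℤ-cong (subsets m) λ P → swap ⟦ (X ⊆? P) ×-dec (P ⊆? Y) ⟧ _)
                 (Σℤ-distribˡ-* (subsets m) -1ℤ (term X Y))))
        (cancel (Σℤ (subsets m) (term X Y))))
    where
    cancel : ∀ a → a + -1ℤ * a ≡ 0ℤ
    cancel = solve-∀
  -- The interval is empty, and again the heads differ.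
  go {suc m} (inside ∷ X) (outside ∷ Y) =
    trans (split (inside ∷ X) (outside ∷ Y))
      (cong₂ _+_ (Σℤ-zero (subsets m) λ _ → refl)
        (Σℤ-zero (subsets m) (inside-zero X)))
  -- The new element is forced, which gives one factor `-1ℤ` on either side.
  go {suc m} (inside ∷ X) (inside ∷ Y) =
    trans (split (inside ∷ X) (inside ∷ Y))
      (trans (cong₂ _+_ (Σℤ-zero (subsets m) λ _ → refl)
               (trans (Σℤ-cong (subsets m) λ P → swap ⟦ (X ⊆? P) ×-dec (P ⊆? Y) ⟧ _)
                 (trans (Σℤ-distribˡ-* (subsets m) -1ℤ (term X Y)) (cong (-1ℤ *_) (go X Y)))))
        (trans (+-identityˡ _) (sym (swap ⟦ X ≟ˢ Y ⟧ (-1ℤ ^ ∣ X ∣)))))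

-- The factor `⟦ Q? P ⟧` only lowers the upper bound: P ⊆ Y and P ⊆ S together mean P ⊆ Y ∩ S. The
-- sum is thus again one over an interval, to which `Σℤ-between` applies.
Σℤ-between-restrict : ∀ {m} (X Y S : Subset m) {Q : Subset m → Set} (Q? : U.Decidable Q) →
  (∀ P → Q P ⇔ P ⊆ S) → (f : Subset m → ℤ) →
  Σℤ (between X Y) (λ P → f P * ⟦ Q? P ⟧) ≡ Σℤ (between X (Y ∩ S)) f
Σℤ-between-restrict {m} X Y S Q? Q⇔ f = begin
  Σℤ (between X Y) (λ P → f P * ⟦ Q? P ⟧)
    ≡⟨ Σℤ-filter _ (subsets m) _ ⟩
  Σℤ (subsets m) (λ P → ⟦ (X ⊆? P) ×-dec (P ⊆? Y) ⟧ * (f P * ⟦ Q? P ⟧))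
    ≡⟨ Σℤ-cong (subsets m) (λ P → trans
         (rotate ⟦ (X ⊆? P) ×-dec (P ⊆? Y) ⟧ (f P) ⟦ Q? P ⟧) (cong (_* f P) (merge P))) ⟩
  Σℤ (subsets m) (λ P → ⟦ (X ⊆? P) ×-dec (P ⊆? (Y ∩ S)) ⟧ * f P)
    ≡⟨ Σℤ-filter _ (subsets m) f ⟨
  Σℤ (between X (Y ∩ S)) f ∎
  where
  open ≡-Reasoning
  rotate : ∀ a b c → a * (b * c) ≡ a * c * b
  rotate = solve-∀
  merge : ∀ P → ⟦ (X ⊆? P) ×-dec (P ⊆? Y) ⟧ * ⟦ Q? P ⟧ ≡ ⟦ (X ⊆? P) ×-dec (P ⊆? (Y ∩ S)) ⟧
  merge P = trans (sym (⟦⟧-× ((X ⊆? P) ×-dec (P ⊆? Y)) (Q? P))) (⟦⟧-cong (mk⇔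
    (λ ((X⊆P , P⊆Y) , q) → (λ {x} → X⊆P {x}) , λ {x} x∈P →
      x∈p∩q⁺ (P⊆Y x∈P , Equivalence.to (Q⇔ P) q x∈P))
    (λ (X⊆P , P⊆) → ((λ {x} → X⊆P {x}) , λ {x} x∈P → p∩q⊆p Y S (P⊆ x∈P)) ,
      Equivalence.from (Q⇔ P) λ {x} x∈P → p∩q⊆q Y S (P⊆ x∈P)))
    (((X ⊆? P) ×-dec (P ⊆? Y)) ×-dec Q? P) ((X ⊆? P) ×-dec (P ⊆? (Y ∩ S))))

-- Prime divisors of t and subgroups of ℤ containing t.

∃-primeDivisor : ∀ m → ∃ λ p → Prime p × p ℕ.∣ 2+ m
∃-primeDivisor m with factorise (2+ m)
... | record { factors = [] ; isFactorisation = () }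
... | record { factors = p ∷ ps ; isFactorisation = eq ; factorsPrime = pr ∷ _ } =
  p , pr , subst (p ℕ.∣_) (sym eq) (ℕ.m∣m*n (product ps))

prime∣^⇒∣ : ∀ {p} → Prime p → ∀ m r → p ℕ.∣ m ℕ.^ r → p ℕ.∣ m
prime∣^⇒∣ pr m zero    p∣1 = contradiction (subst Prime (ℕ.∣1⇒≡1 p∣1) pr) ¬prime[1]
prime∣^⇒∣ pr m (suc r) p∣  with euclidsLemma m (m ℕ.^ r) pr p∣
... | inj₁ p∣m  = p∣m
... | inj₂ p∣m^ = prime∣^⇒∣ pr m r p∣m^

prime∣product⇒∣ : ∀ {p} → Prime p → ∀ {s} (f : Fin s → ℕ) →
                  p ℕ.∣ product (tabulate f) → ∃ λ j → p ℕ.∣ f j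
prime∣product⇒∣ pr {zero}  f p∣1 = contradiction (subst Prime (ℕ.∣1⇒≡1 p∣1) pr) ¬prime[1]
prime∣product⇒∣ pr {suc s} f p∣ with euclidsLemma (f zero) _ pr p∣
... | inj₁ p∣f₀ = zero , p∣f₀
... | inj₂ p∣Π  = let (j , p∣fj) = prime∣product⇒∣ pr (f ∘ suc) p∣Π in suc j , p∣fj

module _ {t : ℕ} (F : PrimePowerFactorisation t) where
  open PrimePowerFactorisation F

  -- By Euclid's lemma q divides some `p j ^ r j`, hence the prime `p j` itself. No prime divisor of
  -- t is missing from the list, and therefore `P*` meets every nontrivial group of rotations.
  ∃-p≡ : ∀ {q} → Prime q → q ℕ.∣ t → ∃ λ j → p j ≡ q
  ∃-p≡ {q} pr q∣t with prime∣product⇒∣ pr _ (subst (q ℕ.∣_) factorisation q∣t)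
  ... | j , q∣p^r with prime⇒irreducible (p-prime j) (prime∣^⇒∣ pr (p j) (r j) q∣p^r)
  ...   | inj₁ refl = contradiction pr ¬prime[1]
  ...   | inj₂ q≡p  = j , sym q≡p

  -- A prime q dividing the cofactor, `2+ m ≡ e * q`, divides t and so equals some `p j`; then
  -- `t/p j` is `e * d`.
  ∃-∣t/p : ∀ m {d} → t ≡ 2+ m ℕ.* d → ∃ λ j → d ℕ.∣ t/p j
  ∃-∣t/p m {d} t≡md with ∃-primeDivisor m
  ... | q , pr , ℕ.divides e m≡eq =
    let (j , p≡q) = ∃-p≡ pr (ℕ.divides (e ℕ.* d) t≡e*d*q)
    in j , ℕ.divides e (t/p≡ j (subst (λ x → t ≡ e ℕ.* d ℕ.* x) (sym p≡q) t≡e*d*q))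
    where
    t≡e*d*q : t ≡ e ℕ.* d ℕ.* q
    t≡e*d*q = begin
      t               ≡⟨ t≡md ⟩
      2+ m ℕ.* d      ≡⟨ cong (ℕ._* d) m≡eq ⟩
      e ℕ.* q ℕ.* d   ≡⟨ ℕ.*-assoc e q d ⟩
      e ℕ.* (q ℕ.* d) ≡⟨ cong (e ℕ.*_) (ℕ.*-comm q d) ⟩
      e ℕ.* (d ℕ.* q) ≡⟨ ℕ.*-assoc e d q ⟨
      e ℕ.* d ℕ.* q   ∎
      where open ≡-Reasoning
    t/p≡ : ∀ j → t ≡ e ℕ.* d ℕ.* p j → t/p j ≡ e ℕ.* d
    t/p≡ j t≡edp = trans (cong (λ u → (u / p j) {{prime⇒nonZero (p-prime j)}}) t≡edp)
                         (m*n/n≡m (e ℕ.* d) (p j) {{prime⇒nonZero (p-prime j)}})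

  p∣t : ∀ j → p j ℕ.∣ t
  p∣t j = subst (p j ℕ.∣_) (sym factorisation)
    (ℕ.∣-trans (∣^ (r j) (r-positive j)) (∈⇒∣product (∈-tabulate⁺ j)))
    where
    ∣^ : ∀ r → 1 ℕ.≤ r → p j ℕ.∣ p j ℕ.^ r
    -- A positive exponent is essential here, as `p j` does not divide `p j ^ 0`.
    ∣^ (suc r) _ = ℕ.m∣m*n (p j ℕ.^ r)

  -- Since `p j` exceeds 1 and divides t, the quotient lies strictly between 0 and t. Hence the
  -- rotations in `P*` are not the identity.
  t∤t/p : .{{_ : NonZero t}} → ∀ j → ¬ t ℕ.∣ t/p j
  t∤t/p j = ℕ.>⇒∤ {{ℕ.≢-nonZero t/p≢0}} (m/n<m t (p j) (ℕ.nonTrivial⇒n>1 (p j)))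
    where
    instance
      p≢0 = prime⇒nonZero (p-prime j)
      p≢1 = prime⇒nonTrivial (p-prime j)
    t/p≢0 : t/p j ≢ 0
    t/p≢0 eq = ℕ.≢-nonZero⁻¹ t (trans (sym (m/n*n≡m (p∣t j))) (cong (ℕ._* p j) eq))

  -- Subgroups of ℤ modulo t are treated as their preimages in ℤ, which are the subgroups containing
  -- t. Closure under differences together with this one member yields zero, negatives and
  -- multiples.
  module _ .{{_ : NonZero t}} (H : ℤ → Set)
           (H-sub : ∀ {i j} → H i → H j → H (i - j)) (t∈H : H (+ t)) where

    private
      H-0 : H 0ℤ
      H-0 = subst H (+-inverseʳ (+ t)) (H-sub t∈H t∈H)

      H-neg : ∀ {i} → H i → H (- i)
      H-neg {i} i∈H = subst H (+-identityˡ (- i)) (H-sub H-0 i∈H)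

      H-* : ∀ m {n} → H (+ n) → H (+ (m ℕ.* n))
      H-* zero    n∈H = H-0
      H-* (suc m) {n} n∈H = subst H (eq (+ n) (+ (m ℕ.* n))) (H-sub n∈H (H-neg (H-* m n∈H)))
        where
        eq : ∀ a b → a - (- b) ≡ a + b
        eq = solve-∀

      -- The gcd below is one of natural numbers, so a negative i enters through its absolute value.
      H-∣i∣ : ∀ i → H i → H (+ ∣ i ∣ᶻ)
      H-∣i∣ (+ n)    i∈H = i∈H
      H-∣i∣ -[1+ n ] i∈H = H-neg i∈H

      H-difference : ∀ {a b d} → H (+ a) → H (+ b) → d ℕ.+ b ≡ a → H (+ d)
      H-difference {b = b} {d} a∈H b∈H refl = subst H (eq (+ d) (+ b)) (H-sub a∈H b∈H)
        where
        eq : ∀ d b → d + b - b ≡ d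
        eq = solve-∀

      -- A Bézout identity over ℕ reads d + y n = x m or d + x m = y n; in both forms d is a
      -- difference of two multiples that lie in H.
      H-Bézout : ∀ {d m n} → Bézout.Identity d m n → H (+ m) → H (+ n) → H (+ d)
      H-Bézout (Bézout.+- x y eq) m∈H n∈H = H-difference (H-* x m∈H) (H-* y n∈H) eq
      H-Bézout (Bézout.-+ x y eq) m∈H n∈H = H-difference (H-* y n∈H) (H-* x m∈H) eq

    -- d = gcd (∣ i ∣ , t) lies in H; if d ≠ t, then d ∣ t / p for every prime p ∣ t / d.
    subgroup-trivial : (∀ j → ¬ H (+ t/p j)) → ∀ i → H i → + t ∣ i
    subgroup-trivial t/p∉H i i∈H with Bézout.lemma ∣ i ∣ᶻ t
    ... | Bézout.result d g b with GCD.gcd∣n g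
    ...   | ℕ.divides 0 t≡0 = contradiction t≡0 (ℕ.≢-nonZero⁻¹ t)
    ...   | ℕ.divides 1 t≡d =
      ∣ᵤ⇒∣ (subst (ℕ._∣ ∣ i ∣ᶻ) (sym (trans t≡d (ℕ.*-identityˡ d))) (GCD.gcd∣m g))
    ...   | ℕ.divides (2+ m) t≡md =
      let (j , ℕ.divides e t/p≡ed) = ∃-∣t/p m t≡md
      in contradiction (subst (H ∘ +_) (sym t/p≡ed) (H-* e (H-Bézout b (H-∣i∣ i i∈H) t∈H)))
                       (t/p∉H j)

-- Sets of codes and the set preserving a labeling.

comprehension : {Q : Fin m → Set} → U.Decidable Q → Subset m
comprehension Q? = Vec.tabulate (does ∘ Q?)

∈-comprehension : {Q : Fin m → Set} (Q? : U.Decidable Q) → ∀ {x} → x ∈ₛ comprehension Q? ⇔ Q x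
∈-comprehension Q? {x} = mk⇔
  (λ x∈ → does-true (Q? x) (trans (sym (lookup∘tabulate _ x)) ([]=⇒lookup x∈)))
  (λ q → lookup⇒[]= x _ (trans (lookup∘tabulate _ x) (dec-true (Q? x) q)))
  where
  does-true : {A : Set} (a? : Dec A) → does a? ≡ true → A
  does-true (yes a) _ = a

funToFin-injective : ∀ {m l} {f g : Fin m → Fin l} → funToFin f ≡ funToFin g → ∀ x → f x ≡ g x
funToFin-injective {f = f} {g} eq x =
  trans (sym (finToFun-funToFin f x)) (trans (cong (λ c → finToFun c x) eq) (finToFun-funToFin g x))

module _ {G : Graph n} where

  ∈｛｝⁺ : {σ τ : Automorphism G} → σ ≈ₐ τ → σ ∈ ｛ τ ｝
  ∈｛｝⁺ {σ} {τ} σ≈τ = subst (_∈ₛ ｛ τ ｝) (sym (funToFin-cong σ≈τ)) (x∈⁅x⁆ _)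

  ∈｛｝⁻ : {σ τ : Automorphism G} → σ ∈ ｛ τ ｝ → σ ≈ₐ τ
  ∈｛｝⁻ {σ} {τ} σ∈ = funToFin-injective (x∈⁅y⁆⇒x≡y (funToFin (fun τ)) σ∈)

  ∈-setOf⁺ : ∀ {s} (f : Fin s → Automorphism G) j → f j ∈ setOf (tabulate f)
  ∈-setOf⁺ f zero    = x∈p∪q⁺ (inj₁ (x∈⁅x⁆ _))
  ∈-setOf⁺ f (suc j) = x∈p∪q⁺ (inj₂ (∈-setOf⁺ (f ∘ suc) j))

  ∈-setOf⁻ : ∀ {s} (f : Fin s → Automorphism G) {c} →
             c ∈ₛ setOf (tabulate f) → ∃ λ j → c ≡ funToFin (fun (f j))
  ∈-setOf⁻ {zero}  f c∈ = contradiction c∈ ∉⊥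
  ∈-setOf⁻ {suc s} f c∈ with x∈p∪q⁻ _ _ c∈
  ... | inj₁ c∈₀ = zero , x∈⁅y⁆⇒x≡y _ c∈₀
  ... | inj₂ c∈ᵣ = let (j , eq) = ∈-setOf⁻ (f ∘ suc) c∈ᵣ in suc j , eq

module _ {G : Graph n} (φ : Labeling n k) where

  -- Codes of maps that are not automorphisms all belong to this set, vacuously.
  preservers : MapSet n
  preservers = comprehension λ c → preservedByAll? G ⁅ c ⁆ φ

  private
    ∈-preservers′ : ∀ {c} → c ∈ₛ preservers ⇔ PreservedByAll G ⁅ c ⁆ φ
    ∈-preservers′ = ∈-comprehension λ c → preservedByAll? G ⁅ c ⁆ φ

  ∈-preservers : {σ : Automorphism G} → σ ∈ preservers ⇔ Preserves σ φ
  ∈-preservers {σ} = mk⇔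
    (λ σ∈ → Equivalence.to ∈-preservers′ σ∈ σ (x∈⁅x⁆ _))
    -- An automorphism τ with the code of σ agrees with σ pointwise, so preservation carries over.
    (λ pr → Equivalence.from ∈-preservers′ λ τ τ∈ →
      preserves-resp G φ {σ} {τ} (≈ₐ-sym G {τ} {σ} (∈｛｝⁻ {σ = τ} {σ} τ∈)) pr)

  -- Valid even if P contains codes of maps that are not automorphisms: they impose nothing on φ and
  -- lie in `preservers`.
  preservedByAll⇔⊆ : ∀ P → PreservedByAll G P φ ⇔ P ⊆ preservers
  preservedByAll⇔⊆ P = mk⇔
    (λ all {c} c∈P → Equivalence.from ∈-preservers′
      λ τ τ∈ → all τ (subst (_∈ₛ P) (sym (x∈⁅y⁆⇒x≡y c τ∈)) c∈P))
    (λ P⊆S σ σ∈P → Equivalence.to (∈-preservers {σ}) (P⊆S σ∈P))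

  Σℤ-preservedByAll : ∀ A B (f : MapSet n → ℤ) →
    Σℤ (between A B) (λ P → f P * ⟦ preservedByAll? G P φ ⟧) ≡ Σℤ (between A (B ∩ preservers)) f
  Σℤ-preservedByAll A B =
    Σℤ-between-restrict A B preservers (λ P → preservedByAll? G P φ) preservedByAll⇔⊆

-- Rotations and reflections as automorphisms.

module _ {G : Graph n} {t : ℕ} .{{_ : NonZero t}} (π : Dihedral → Automorphism G)
         (iso : IsIsomorphism (D t) (Aut G) π) (F : PrimePowerFactorisation t) where

  open PrimePowerFactorisation F using (t/p)
  open GroupMorphisms.IsGroupIsomorphism iso
    using (∙-homo; ε-homo; ⁻¹-homo; injective; surjective) renaming (⟦⟧-cong to π-cong)

  ρ^t/p : Fin _ → Automorphism G
  ρ^t/p j = π (ρ^ (+ t/p j))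

  -- Equal codes would make a reflection and a rotation equal in `D t`, and `DihedralEq` has no
  -- constructor for that.
  τρ∉P* : ∀ i → ¬ (π (τρ^ i) ∈ P* π F)
  τρ∉P* i c∈ with ∈-setOf⁻ ρ^t/p c∈
  ... | j , eq with injective (funToFin-injective eq)
  ...   | ()

  ρ^t/p≉ε : ∀ j → ¬ DihedralEq t (ρ^ (+ t/p j)) (ρ^ 0ℤ)
  ρ^t/p≉ε j (ρ≈ d) = t∤t/p F j (subst (t ℕ.∣_) (cong ∣_∣ᶻ (+-identityʳ (+ t/p j))) (∣⇒∣ᵤ d))

  π≈id⇒≈ε : ∀ x → π x ≈ₐ idₐ → DihedralEq t x (ρ^ 0ℤ)
  π≈id⇒≈ε x πx≈id = injective (Group.trans (Aut G) {π x} {idₐ} {π (ρ^ 0ℤ)} πx≈id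
    (≈ₐ-sym G {π (ρ^ 0ℤ)} {idₐ} ε-homo))

  -- Two residues below t differ by less than t in absolute value, and the only such multiple of t
  -- is 0.
  toℕ-injective-mod : (i j : Fin t) → + t ∣ (+ toℕ i - + toℕ j) → i ≡ j
  toℕ-injective-mod i j d = toℕ-injective (ℤ.+-injective
    (ℤ.i-j≡0⇒i≡j (+ toℕ i) (+ toℕ j) (ℤ.∣i∣≡0⇒i≡0 (small (∣⇒∣ᵤ d) ∣i-j∣<t))))
    where
    small : ∀ {a} → t ℕ.∣ a → a ℕ.< t → a ≡ 0
    small {zero}  _   _   = refl
    small {suc a} t∣a a<t = contradiction t∣a (ℕ.>⇒∤ a<t)
    ∣i-j∣<t : ∣ + toℕ i - + toℕ j ∣ᶻ ℕ.< t
    ∣i-j∣<t = subst (λ z → ∣ z ∣ᶻ ℕ.< t) (sym (ℤ.m-n≡m⊖n (toℕ i) (toℕ j)))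
      (ℕ.≤-<-trans (ℤ.∣m⊝n∣≤m⊔n (toℕ i) (toℕ j)) (ℕ.⊔-lub (toℕ<n i) (toℕ<n j)))

  reduce : ∀ i → ∃ λ (r : Fin t) → DihedralEq t (τρ^ i) (τρ^ (+ toℕ r))
  reduce i = fromℕ< (n%ℕd<d i t) , τρ≈ (divides (i /ℕ t) (begin
    i - + toℕ (fromℕ< (n%ℕd<d i t))        ≡⟨ cong (λ r → i - + r) (toℕ-fromℕ< (n%ℕd<d i t)) ⟩
    i - + (i %ℕ t)                         ≡⟨ cong (_- + (i %ℕ t)) (a≡a%ℕn+[a/ℕn]*n i t) ⟩
    + (i %ℕ t) + (i /ℕ t) * + t - + (i %ℕ t) ≡⟨ cancel (+ (i %ℕ t)) ((i /ℕ t) * + t) ⟩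
    (i /ℕ t) * + t                         ∎))
    where
    open ≡-Reasoning
    cancel : ∀ a b → a + b - a ≡ b
    cancel = solve-∀

  -- The stabiliser of one labeling.

  module _ (φ : Labeling n k) where

    Fixes : Dihedral → Set
    Fixes x = Preserves (π x) φ

    fixes-resp : ∀ {x y} → DihedralEq t x y → Fixes x → Fixes y
    fixes-resp {x} {y} x≈y = preserves-resp G φ {π x} {π y} (π-cong x≈y)

    fixes-∙ : ∀ x y → Fixes x → Fixes y → Fixes (x ∙ᴰ y)
    fixes-∙ x y fx fy v = trans (cong φ (∙-homo x y v)) (trans (fx _) (fy v))

    fixes-ε : Fixes (ρ^ 0ℤ)
    fixes-ε v = cong φ (ε-homo v)

    fixes-⁻¹ : ∀ x → Fixes x → Fixes (x ⁻¹ᴰ)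
    fixes-⁻¹ x fx v = trans (cong φ (⁻¹-homo x v))
      (trans (sym (fx _)) (cong φ (fun-inv (π x) v)))

    -- Amounts to the identity being the only rotation that preserves φ, in a form that refers to
    -- `P*` and is decided by finitely many checks.
    Free : Set
    Free = ∀ j → ¬ Fixes (ρ^ (+ t/p j))

    free? : Dec Free
    free? = all? λ j → ¬? (preserves? G (π (ρ^ (+ t/p j))) φ)

    -- The exponents i with `Fixes (ρ^ i)` form a subgroup of ℤ, which contains t because the t-th
    -- power of ρ is the identity; `subgroup-trivial` applies to it.
    rotation-trivial : Free → ∀ {i} → Fixes (ρ^ i) → DihedralEq t (ρ^ i) (ρ^ 0ℤ)
    rotation-trivial free {i} fi = ρ≈ (subst (+ t ∣_) (sym (+-identityʳ i))
      (subgroup-trivial F (Fixes ∘ ρ^_)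
        (λ {i} {j} fi fj → fixes-∙ (ρ^ i) (ρ^ (- j)) fi (fixes-⁻¹ (ρ^ j) fj))
        (fixes-resp (Group.sym (D t) t≈0) fixes-ε) free i fi))
      where
      t≈0 : DihedralEq t (ρ^ (+ t)) (ρ^ 0ℤ)
      t≈0 = ρ≈ (divides 1ℤ (trans (+-identityʳ (+ t)) (sym (*-identityˡ (+ t)))))

    -- The product of `τρ^ i` and `τρ^ j` is the rotation with exponent j - i, which is trivial by
    -- `rotation-trivial`.
    reflection-unique : Free → ∀ {i j} → Fixes (τρ^ i) → Fixes (τρ^ j) →
                        DihedralEq t (τρ^ j) (τρ^ i)
    reflection-unique free {i} {j} fi fj
      with rotation-trivial free (fixes-∙ (τρ^ i) (τρ^ j) fi fj)
    ... | ρ≈ d = τρ≈ (subst (+ t ∣_) (eq i j) d)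
      where
      eq : ∀ i j → - i + j - 0ℤ ≡ j - i
      eq = solve-∀

    classify : ∀ σ → Preserves σ φ → ∃ λ x → σ ≈ₐ π x × Fixes x
    classify σ pr =
      let (x , πx≈) = surjective σ
          σ≈πx = ≈ₐ-sym G {π x} {σ} (πx≈ (Group.refl (D t) {x}))
      in x , σ≈πx , preserves-resp G φ {σ} {π x} σ≈πx pr

    -- From left to right, a rotation in `P*` is neither the identity nor a reflection. From right
    -- to left, `rotation-trivial` and `reflection-unique` leave no further element in the
    -- stabiliser.
    exactly⇔ : ∀ i → PreservedByExactly G (｛ π (ρ^ 0ℤ) ｝ ∪ ｛ π (τρ^ i) ｝) φ ⇔ (Fixes (τρ^ i) × Free)
    exactly⇔ i = mk⇔ to from
      where
      to : _ → _
      to ex = Equivalence.to (ex (π (τρ^ i))) (x∈p∪q⁺ (inj₂ (x∈⁅x⁆ _))) , free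
        where
        free : Free
        free j fj with x∈p∪q⁻ _ _ (Equivalence.from (ex (ρ^t/p j)) fj)
        ... | inj₁ ∈ρ = ρ^t/p≉ε j (injective (∈｛｝⁻ {σ = ρ^t/p j} {π (ρ^ 0ℤ)} ∈ρ))
        ... | inj₂ ∈τ with injective (∈｛｝⁻ {σ = ρ^t/p j} {π (τρ^ i)} ∈τ)
        ...   | ()
      from : _ → _
      from (fi , free) σ = mk⇔ there back
        where
        there : _
        there σ∈ with x∈p∪q⁻ ｛ π (ρ^ 0ℤ) ｝ _ σ∈
        ... | inj₁ ∈ρ = preserves-resp G φ {π (ρ^ 0ℤ)} {σ}
          (≈ₐ-sym G {σ} {π (ρ^ 0ℤ)} (∈｛｝⁻ {σ = σ} {π (ρ^ 0ℤ)} ∈ρ)) fixes-ε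
        ... | inj₂ ∈τ = preserves-resp G φ {π (τρ^ i)} {σ}
          (≈ₐ-sym G {σ} {π (τρ^ i)} (∈｛｝⁻ {σ = σ} {π (τρ^ i)} ∈τ)) fi
        back : Preserves σ φ → σ ∈ (｛ π (ρ^ 0ℤ) ｝ ∪ ｛ π (τρ^ i) ｝)
        back pr with classify σ pr
        ... | ρ^ l , σ≈ , fl = x∈p∪q⁺ (inj₁ (∈｛｝⁺ {σ = σ} {π (ρ^ 0ℤ)}
          (Group.trans (Aut G) {σ} {π (ρ^ l)} {π (ρ^ 0ℤ)} σ≈ (π-cong (rotation-trivial free fl)))))
        ... | τρ^ l , σ≈ , fl = x∈p∪q⁺ (inj₂ (∈｛｝⁺ {σ = σ} {π (τρ^ i)}
          (Group.trans (Aut G) {σ} {π (τρ^ l)} {π (τρ^ i)} σ≈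
            (π-cong (reflection-unique free fi fl)))))

    -- `Free` excludes the nontrivial rotations, and by `reduce` the t listed exponents account for
    -- all reflections.
    distinguishing⇔ : Distinguishing G φ ⇔ (Free × ∀ i → ¬ Fixes (τρ^ (+ toℕ {t} i)))
    distinguishing⇔ = mk⇔ to from
      where
      to : _ → _
      to dist = (λ j fj → ρ^t/p≉ε j (π≈id⇒≈ε _ (dist (ρ^t/p j) fj)))
              , λ i fi → case π≈id⇒≈ε _ (dist (π (τρ^ (+ toℕ i))) fi) of λ ()
      from : _ → _
      from (free , no-τ) σ pr with classify σ pr
      ... | ρ^ l , σ≈ , fl =
        Group.trans (Aut G) {σ} {π (ρ^ l)} {idₐ} σ≈
          (Group.trans (Aut G) {π (ρ^ l)} {π (ρ^ 0ℤ)} {idₐ}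
            (π-cong (rotation-trivial free fl)) ε-homo)
      ... | τρ^ l , σ≈ , fl =
        let (r , l≈r) = reduce l in contradiction (fixes-resp l≈r fl) (no-τ r)

    reflection-unique-toℕ : Free → ∀ (i j : Fin t) →
                            Fixes (τρ^ (+ toℕ i)) → Fixes (τρ^ (+ toℕ j)) → j ≡ i
    reflection-unique-toℕ free i j fi fj with reflection-unique free fi fj
    ... | τρ≈ d = toℕ-injective-mod j i d

    exactly? : ∀ i → Dec (PreservedByExactly G (｛ π (ρ^ 0ℤ) ｝ ∪ ｛ π (τρ^ i) ｝) φ)
    exactly? i = preservedByExactly? G (｛ π (ρ^ 0ℤ) ｝ ∪ ｛ π (τρ^ i) ｝) φ

    -- Without `Free` every term is 0. With it, the equation reads 1 = 1 - 0 if no reflection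
    -- preserves φ, and 0 = 1 - 1 otherwise.
    ⟦distinguishing⟧ : ⟦ distinguishing? G φ ⟧ ≡
                       ⟦ free? ⟧ - Σℤ (allFin t) (λ i → ⟦ exactly? (+ toℕ i) ⟧)
    ⟦distinguishing⟧ = go free? (any? λ i → preserves? G (π (τρ^ (+ toℕ i))) φ)
      where
      fixes∧free : ∀ i → PreservedByExactly G _ φ → Fixes (τρ^ (+ toℕ i)) × Free
      fixes∧free i = Equivalence.to (exactly⇔ (+ toℕ i))

      go : Dec Free → Dec (∃ λ (i : Fin t) → Fixes (τρ^ (+ toℕ i))) →
           ⟦ distinguishing? G φ ⟧ ≡ ⟦ free? ⟧ - Σℤ (allFin t) (λ i → ⟦ exactly? (+ toℕ i) ⟧)
      go (no ¬free) _ = trans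
        (⟦⟧-false (distinguishing? G φ) (¬free ∘ proj₁ ∘ Equivalence.to distinguishing⇔))
        (sym (cong₂ _-_ (⟦⟧-false free? ¬free)
          (Σℤ-zero (allFin t) λ i → ⟦⟧-false (exactly? (+ toℕ i)) (¬free ∘ proj₂ ∘ fixes∧free i))))
      go (yes free) (no none) = trans
        (⟦⟧-true (distinguishing? G φ)
          (Equivalence.from distinguishing⇔ (free , λ i fi → none (i , fi))))
        (sym (cong₂ _-_ (⟦⟧-true free? free)
          (Σℤ-zero (allFin t) λ i →
            ⟦⟧-false (exactly? (+ toℕ i)) λ ex → none (i , proj₁ (fixes∧free i ex)))))
      -- By uniqueness of the preserving reflection, i gives the only nonzero summand.
      go (yes free) (yes (i , fi)) = trans
        (⟦⟧-false (distinguishing? G φ) λ dist → proj₂ (Equivalence.to distinguishing⇔ dist) i fi)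
        (sym (cong₂ _-_ (⟦⟧-true free? free) (trans
          (Σℤ-tabulate-single id (λ i → ⟦ exactly? (+ toℕ i) ⟧) i λ j j≢i →
            ⟦⟧-false (exactly? (+ toℕ j)) λ ex →
              j≢i (reflection-unique-toℕ free i j fi (proj₁ (fixes∧free j ex))))
          (⟦⟧-true (exactly? (+ toℕ i)) (Equivalence.from (exactly⇔ (+ toℕ i)) (fi , free))))))

    -- Inclusion-exclusion for one labeling.

    free⇔ : Free ⇔ Empty (P* π F ∩ preservers {G = G} φ)
    free⇔ = mk⇔ to from
      where
      S = preservers {G = G} φ
      to : _ → _
      to free (c , c∈) with x∈p∩q⁻ (P* π F) S c∈
      ... | c∈P* , c∈S with ∈-setOf⁻ ρ^t/p c∈P*
      ...   | j , refl = free j (Equivalence.to (∈-preservers φ {ρ^t/p j}) c∈S)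
      from : _ → _
      from empty j fj = empty (_ , x∈p∩q⁺
        (∈-setOf⁺ ρ^t/p j , Equivalence.from (∈-preservers φ {ρ^t/p j}) fj))

    -- Restricted to the preserving codes S, the interval runs from `⊥` to `P* ∩ S`. Its alternating
    -- sum survives only if that intersection is empty, and then with sign +1.
    Σℤ-rotations : Σℤ (between ⊥ (P* π F)) (λ P → -1ℤ ^ ∣ P ∣ * ⟦ preservedByAll? G P φ ⟧)
                   ≡ ⟦ free? ⟧
    Σℤ-rotations = begin
      Σℤ (between ⊥ (P* π F)) (λ P → -1ℤ ^ ∣ P ∣ * ⟦ preservedByAll? G P φ ⟧)
        ≡⟨ Σℤ-preservedByAll φ ⊥ (P* π F) _ ⟩
      Σℤ (between ⊥ (P* π F ∩ S)) (λ P → -1ℤ ^ ∣ P ∣)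
        ≡⟨ Σℤ-between ⊥ (P* π F ∩ S) ⟩
      ⟦ ⊥ ≟ˢ (P* π F ∩ S) ⟧ * -1ℤ ^ ∣ ⊥ {n ℕ.^ n} ∣
        ≡⟨ cong (λ e → ⟦ ⊥ ≟ˢ (P* π F ∩ S) ⟧ * -1ℤ ^ e) (∣⊥∣≡0 (n ℕ.^ n)) ⟩
      ⟦ ⊥ ≟ˢ (P* π F ∩ S) ⟧ * 1ℤ
        ≡⟨ ℤ.*-identityʳ _ ⟩
      ⟦ ⊥ ≟ˢ (P* π F ∩ S) ⟧
        ≡⟨ ⟦⟧-cong ⊥≡⇔ (⊥ ≟ˢ (P* π F ∩ S)) free? ⟩
      ⟦ free? ⟧ ∎
      where
      open ≡-Reasoning
      S = preservers {G = G} φ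
      ⊥≡⇔ : ⊥ ≡ P* π F ∩ S ⇔ Free
      ⊥≡⇔ = mk⇔ (λ eq → Equivalence.from free⇔ λ (c , c∈) → ∉⊥ (subst (c ∈ₛ_) (sym eq) c∈))
                 (λ free → sym (Empty-unique (Equivalence.to free⇔ free)))

    -- With T the singleton of the reflection, the alternating sum detects T = (T ∪ P*) ∩ S. As the
    -- reflection is not in `P*`, this says that it preserves φ and that nothing in `P*` does.
    Σℤ-reflection : ∀ i → let T = ｛ π (τρ^ i) ｝ in
      Σℤ (between T (T ∪ P* π F)) (λ P → -1ℤ ^ (∣ P ∣ ∸ 1) * ⟦ preservedByAll? G P φ ⟧)
      ≡ ⟦ exactly? i ⟧
    Σℤ-reflection i = begin
      Σℤ (between T (T ∪ P* π F)) (λ P → -1ℤ ^ (∣ P ∣ ∸ 1) * ⟦ preservedByAll? G P φ ⟧)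
        ≡⟨ Σℤ-preservedByAll φ T (T ∪ P* π F) _ ⟩
      Σℤ (between T Y) (λ P → -1ℤ ^ (∣ P ∣ ∸ 1))
        -- Every P in the interval contains T, so its cardinality is at least 1 and `∸` does not
        -- truncate.
        ≡⟨ Σℤ-filter-cong (λ P → (T ⊆? P) ×-dec (P ⊆? Y)) (subsets (n ℕ.^ n)) (λ P (T⊆P , _) →
             pred-sign ∣ P ∣ (subst (ℕ._≤ ∣ P ∣) (∣⁅x⁆∣≡1 c) (p⊆q⇒∣p∣≤∣q∣ {p = T} {P} T⊆P))) ⟩
      Σℤ (between T Y) (λ P → - (-1ℤ ^ ∣ P ∣))
        ≡⟨ Σℤ-neg (between T Y) _ ⟩
      - Σℤ (between T Y) (λ P → -1ℤ ^ ∣ P ∣)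
        ≡⟨ cong -_ (Σℤ-between T Y) ⟩
      - (⟦ T ≟ˢ Y ⟧ * -1ℤ ^ ∣ T ∣)
        ≡⟨ cong (λ e → - (⟦ T ≟ˢ Y ⟧ * -1ℤ ^ e)) (∣⁅x⁆∣≡1 c) ⟩
      - (⟦ T ≟ˢ Y ⟧ * -1ℤ)
        ≡⟨ neg-*-neg ⟦ T ≟ˢ Y ⟧ ⟩
      ⟦ T ≟ˢ Y ⟧
        ≡⟨ ⟦⟧-cong T≡⇔ (T ≟ˢ Y) (exactly? i) ⟩
      ⟦ exactly? i ⟧ ∎
      where
      open ≡-Reasoning
      S = preservers {G = G} φ
      c = funToFin (fun (π (τρ^ i)))
      T = ｛ π (τρ^ i) ｝
      Y = (T ∪ P* π F) ∩ S
      neg-*-neg : ∀ a → - (a * -1ℤ) ≡ a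
      neg-*-neg = solve-∀
      pred-sign : ∀ e → 1 ℕ.≤ e → -1ℤ ^ (e ∸ 1) ≡ - (-1ℤ ^ e)
      pred-sign (suc e) _ = double-neg (-1ℤ ^ e)
        where
        double-neg : ∀ a → a ≡ - (-1ℤ * a)
        double-neg = solve-∀
      T≡⇔ : T ≡ Y ⇔ PreservedByExactly G (｛ π (ρ^ 0ℤ) ｝ ∪ T) φ
      T≡⇔ = mk⇔ (Equivalence.from (exactly⇔ i) ∘ to) (from ∘ Equivalence.to (exactly⇔ i))
        where
        to : T ≡ Y → Fixes (τρ^ i) × Free
        to eq = Equivalence.to (∈-preservers φ {π (τρ^ i)})
                  (proj₂ (x∈p∩q⁻ (T ∪ P* π F) S (subst (c ∈ₛ_) eq (x∈⁅x⁆ c))))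
              -- A member of `P* ∩ S` lies in Y = T, so it is the code of the reflection, contrary
              -- to `τρ∉P*`.
              , Equivalence.from free⇔ λ (x , x∈) →
                  let (x∈P* , x∈S) = x∈p∩q⁻ (P* π F) S x∈
                      x≡c = x∈⁅y⁆⇒x≡y c (subst (x ∈ₛ_) (sym eq) (x∈p∩q⁺ (x∈p∪q⁺ (inj₂ x∈P*) , x∈S)))
                  in τρ∉P* i (subst (_∈ₛ P* π F) x≡c x∈P*)
        from : Fixes (τρ^ i) × Free → T ≡ Y
        from (fi , free) = ⊆-antisym T⊆Y Y⊆T
          where
          T⊆Y : T ⊆ Y
          T⊆Y x∈T = x∈p∩q⁺ (x∈p∪q⁺ (inj₁ x∈T)
            , subst (_∈ₛ S) (sym (x∈⁅y⁆⇒x≡y c x∈T))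
                (Equivalence.from (∈-preservers φ {π (τρ^ i)}) fi))
          Y⊆T : Y ⊆ T
          Y⊆T {x} x∈Y with x∈p∩q⁻ (T ∪ P* π F) S x∈Y
          ... | x∈T∪P* , x∈S with x∈p∪q⁻ T (P* π F) x∈T∪P*
          ...   | inj₁ x∈T  = x∈T
          ...   | inj₂ x∈P* = contradiction (x , x∈p∩q⁺ (x∈P* , x∈S)) (Equivalence.to free⇔ free)

-- From one labeling to counts, by exchanging sums.

Σℤ-N≥ : (G : Graph n) (k : ℕ) (Ps : List (MapSet n)) (f : MapSet n → ℤ) →
  Σℤ Ps (λ P → f P * + N≥ G k P) ≡
  Σℤ (allFin (k ℕ.^ n)) (λ c → Σℤ Ps (λ P → f P * ⟦ preservedByAll? G P (finToFun {k} {n} c) ⟧))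
Σℤ-N≥ {n} G k Ps f = trans
  (Σℤ-cong Ps λ P → trans (cong (f P *_) (length-filter _ (allFin (k ℕ.^ n))))
    (sym (Σℤ-distribˡ-* (allFin (k ℕ.^ n)) (f P) _)))
  (Σℤ-comm Ps (allFin (k ℕ.^ n)) _)

theorem3 : ∀ {n : ℕ} (G : Graph n) (t : ℕ) .{{_ : NonZero t}}
    (π : Dihedral → Automorphism G) → IsIsomorphism (D t) (Aut G) π →
    (F : PrimePowerFactorisation t) (k : ℕ) .{{_ : NonZero k}} →
    (∀ (i : Fin t) →
    + N₌ G k (｛ π (ρ^ 0ℤ) ｝ ∪ ｛ π (τρ^ (+ toℕ i)) ｝)
    ≡ Σℤ (between ｛ π (τρ^ (+ toℕ i)) ｝ (｛ π (τρ^ (+ toℕ i)) ｝ ∪ P* π F))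
    (λ P → -1ℤ ^ (∣ P ∣ ∸ 1) * + N≥ G k P))
    × (+ L G k
    ≡ Σℤ (between ⊥ (P* π F)) (λ P → -1ℤ ^ ∣ P ∣ * + N≥ G k P)
    - Σℤ (allFin t) (λ i → + N₌ G k (｛ π (ρ^ 0ℤ) ｝ ∪ ｛ π (τρ^ (+ toℕ i)) ｝)))
theorem3 {n} G t π iso F k = N₌-formula , L-formula
  where
  open ≡-Reasoning
  labelings = allFin (k ℕ.^ n)
  label : Fin (k ℕ.^ n) → Labeling n k
  label = finToFun {k} {n}
  exact? : ∀ i c → _
  exact? i c = exactly? π iso F (label c) i

  N₌-formula : (i : Fin t) → _
  N₌-formula i = begin
    + N₌ G k (｛ π (ρ^ 0ℤ) ｝ ∪ ｛ π (τρ^ (+ toℕ i)) ｝)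
      ≡⟨ length-filter _ labelings ⟩
    Σℤ labelings (λ c → ⟦ exact? (+ toℕ i) c ⟧)
      ≡⟨ Σℤ-cong labelings (λ c → sym (Σℤ-reflection π iso F (label c) (+ toℕ i))) ⟩
    Σℤ labelings (λ c → Σℤ (between T (T ∪ P* π F))
                           (λ P → -1ℤ ^ (∣ P ∣ ∸ 1) * ⟦ preservedByAll? G P (label c) ⟧))
      ≡⟨ Σℤ-N≥ G k (between T (T ∪ P* π F)) (λ P → -1ℤ ^ (∣ P ∣ ∸ 1)) ⟨
    Σℤ (between T (T ∪ P* π F)) (λ P → -1ℤ ^ (∣ P ∣ ∸ 1) * + N≥ G k P) ∎
    where T = ｛ π (τρ^ (+ toℕ i)) ｝

  L-formula : _
  L-formula = begin
    + L G k
      ≡⟨ length-filter _ labelings ⟩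
    Σℤ labelings (λ c → ⟦ distinguishing? G (label c) ⟧)
      ≡⟨ Σℤ-cong labelings (λ c → ⟦distinguishing⟧ π iso F (label c)) ⟩
    Σℤ labelings (λ c → ⟦ free? π iso F (label c) ⟧ - Σℤ (allFin t) (λ i → ⟦ exact? (+ toℕ i) c ⟧))
      ≡⟨ Σℤ-distrib-- labelings _ _ ⟩
    Σℤ labelings (λ c → ⟦ free? π iso F (label c) ⟧)
    - Σℤ labelings (λ c → Σℤ (allFin t) (λ i → ⟦ exact? (+ toℕ i) c ⟧))
      ≡⟨ cong₂ _-_
           (trans (Σℤ-cong labelings (λ c → sym (Σℤ-rotations π iso F (label c))))
             (sym (Σℤ-N≥ G k (between ⊥ (P* π F)) (λ P → -1ℤ ^ ∣ P ∣))))
           -- Summing over labelings first, for each fixed i, recovers the counts `N₌`.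
           (trans (Σℤ-comm labelings (allFin t) _)
             (Σℤ-cong (allFin t) λ i → sym (length-filter _ labelings))) ⟩
    Σℤ (between ⊥ (P* π F)) (λ P → -1ℤ ^ ∣ P ∣ * + N≥ G k P)
    - Σℤ (allFin t) (λ i → + N₌ G k (｛ π (ρ^ 0ℤ) ｝ ∪ ｛ π (τρ^ (+ toℕ i)) ｝)) ∎
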